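{- Let $s_{l_1},s_{l_2},\dots,s_{l_t}$ be a finite number ($t\ge 1$) of ordered strings of non-negative integers, and for each $i$ let $k_i$ be the maximum entry of $s_{l_i}$. Then the generalised ornated graph $O_n(s_{l_1},\dots,s_{l_t})$ of smallest order $n$ that attains the maximum possible degree $\max_{n'\ge 1}\Delta(O_{n'}(s_{l_1},\dots,s_{l_t}))$ has $n=2\max_{1\le i\le t}k_i+1$ vertices, and for this $n$ one has $\Delta(O_n(s_{l_1},s_{l_2},\dots,s_{l_t}))=\sum_{j=1}^{t}\Delta(O_n(s_{l_j}))$.
   Context: An ordered string $s_l=(a_j)$, $1\le j\le l$ ($l\ge 1$), is an $l$-tuple of non-negative integers; $j$ is the index of the entry $a_j$. For a positive integer $n$, the ornated graph $O_n(s_l)$ is the (in general non-simple) directed graph on vertices $v_1,\dots,v_n$ whose arcs, counted with multiplicity, are the following: each odd-indexed entry $a_t$ contributes one arc $(v_i,v_j)$ for every pair $i<j$ with $i+a_t\ge j$; each even-indexed entry $a_s$ contributes one arc $(v_i,v_j)$ for every pair $i>j$ with $i-a_s\le j$. The generalised ornated graph $O_n(s_{l_1},\dots,s_{l_t})=\sum_{i=1}^{t}O_n(s_{l_i})$ is obtained by applying the strings consecutively to the same $n$ vertices: its vertex set is $\{v_1,\dots,v_n\}$ and its arc multiplicities are the sums of the arc multiplicities of the graphs $O_n(s_{l_i})$ (each string having its own indexing). The degree of a vertex is $d(v)=d^+(v)+d^-(v)$ (out-degree plus in-degree, with multiplicity), and $\Delta$ denotes the maximum degree. -}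

module Defs where

open import Data.Bool using (if_then_else_)
open import Data.Fin using (Fin; toℕ)
open import Data.Nat using (ℕ; suc; _+_; _∸_; _⊔_; _≤_; _<_; _≤?_; _<?_; parity)
open import Data.Nat.Properties using (+-0-commutativeMonoid)
open import Data.Parity.Base using (0ℙ; 1ℙ)
open import Data.Product using (_×_)
open import Data.Vec.Functional using (Vector; foldr)
open import Relation.Nullary using (Dec; does; _×-dec_)

open import Algebra.Properties.CommutativeMonoid.Sum +-0-commutativeMonoid public
  using (sum-syntax)

-- The seed 0 is only visible for the empty vector; all entries are naturals.
maximum : ∀ {n} → Vector ℕ n → ℕ
maximum = foldr _⊔_ 0

-- G u v is the number of arcs from u to v.
MultiDigraph : ℕ → Set
MultiDigraph n = Fin n → Fin n → ℕ

outDegree inDegree degree : ∀ {n} → MultiDigraph n → Fin n → ℕ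
outDegree {n} G v = ∑[ u < n ] G v u
inDegree  {n} G v = ∑[ u < n ] G u v
degree G v = outDegree G v + inDegree G v

Δ : ∀ {n} → MultiDigraph n → ℕ
Δ G = maximum (degree G)

OrderedString : ℕ → Set
OrderedString l = Vector ℕ l

count : ∀ {P : Set} → Dec P → ℕ
count P? = if does P? then 1 else 0

-- Vertices are numbered from 0 here, so v_i is the element with toℕ equal to
-- i - 1.  The arc conditions are invariant under this shift; cutting i - a off
-- at 0 is harmless, as it is compared with a vertex number, which is ≥ 0.
forwardArcs backwardArcs : ∀ n → ℕ → MultiDigraph n
forwardArcs n a i j =
  count ((toℕ i <? toℕ j) ×-dec (toℕ j ≤? toℕ i + a))
backwardArcs n a i j =
  count ((toℕ j <? toℕ i) ×-dec (toℕ i ∸ a ≤? toℕ j))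

-- The first argument after n is the index of the entry, counted from 1.
entryArcs : ∀ n → ℕ → ℕ → MultiDigraph n
entryArcs n index a with parity index
... | 1ℙ = forwardArcs n a
... | 0ℙ = backwardArcs n a

ornated : ∀ n {l} → OrderedString l → MultiDigraph n
ornated n {l} s u v = ∑[ j < l ] entryArcs n (suc (toℕ j)) (s j) u v

generalisedOrnated : ∀ n {t} {l : Fin t → ℕ} →
                     (∀ i → OrderedString (l i)) → MultiDigraph n
generalisedOrnated n {t} s u v = ∑[ i < t ] ornated n (s i) u v

-- For a family G of graphs indexed by their order: n is a positive order whose
-- maximum degree equals max_{n' ≥ 1} Δ(G n').
AttainsMaxDegree : (∀ n → MultiDigraph n) → ℕ → Set
AttainsMaxDegree G n = 1 ≤ n × (∀ n′ → 1 ≤ n′ → Δ (G n′) ≤ Δ (G n))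

SmallestAttainingMaxDegree : (∀ n → MultiDigraph n) → ℕ → Set
SmallestAttainingMaxDegree G n =
  AttainsMaxDegree G n × (∀ m → AttainsMaxDegree G m → n ≤ m)

{-# OPTIONS --safe #-}
-- Truncating at the borders of the vertex range, an entry a contributes
-- a ⊓ (number of later vertices) + a ⊓ (number of earlier vertices) to the
-- degree of a vertex, whatever the parity of its index.  Hence every degree is
-- at most twice the sum of all entries, with equality exactly at a vertex that
-- has at least K earlier and K later vertices, K being the largest entry.  Such
-- a vertex exists iff n ≥ 2K + 1, and for n = 2K + 1 the central vertex
-- maximises the degree in all the graphs O_n(s_j) simultaneously.
module Submission where

open import Defs
open import Data.Bool using (if_then_else_)
open import Data.Fin using (Fin; zero; suc; toℕ; fromℕ<)
open import Data.Fin.Properties using (toℕ<n; toℕ-fromℕ<)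
open import Data.Nat
  using (ℕ; zero; suc; _+_; _*_; _∸_; _⊓_; _≤_; _<_; _≤?_; _<?_; z≤n; s≤s; s≤s⁻¹; parity)
open import Data.Nat.Properties
open import Data.Nat.Tactic.RingSolver using (solve-∀)
open import Data.Parity.Base using (0ℙ; 1ℙ)
open import Data.Product using (_×_; _,_; ∃; proj₁; proj₂; map₂; swap)
open import Data.Sum using (inj₁; inj₂)
open import Data.Vec.Functional using (Vector)
open import Function using (_∘_; _⇔_; mk⇔; module Equivalence)
open import Relation.Binary.PropositionalEquality
  using (_≡_; refl; sym; trans; cong; cong₂; subst; module ≡-Reasoning)
open import Relation.Nullary using (Dec; _×-dec_)
open import Relation.Nullary.Decidable using (does-⇔)

open import Algebra.Properties.CommutativeMonoid.Sum +-0-commutativeMonoid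
  using (sum; sum-cong-≗; ∑-distrib-+; ∑-comm; sum-replicate-zero)

≤-maximum : ∀ {n} (f : Vector ℕ n) i → f i ≤ maximum f
≤-maximum f zero    = m≤m⊔n _ _
≤-maximum f (suc i) = ≤-trans (≤-maximum (f ∘ suc) i) (m≤n⊔m (f zero) _)

maximum-lub : ∀ {n b} (f : Vector ℕ n) → (∀ i → f i ≤ b) → maximum f ≤ b
maximum-lub {zero}  f f≤b = z≤n
maximum-lub {suc n} f f≤b = ⊔-lub (f≤b zero) (maximum-lub (f ∘ suc) (f≤b ∘ suc))

maximum-attained : ∀ {n} → 1 ≤ n → (f : Vector ℕ n) → ∃ λ i → maximum f ≡ f i
maximum-attained {suc zero}    _ f = zero , ⊔-identityʳ (f zero)
maximum-attained {suc (suc n)} _ f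
  with ⊔-sel (f zero) (maximum (f ∘ suc)) | maximum-attained (s≤s z≤n) (f ∘ suc)
... | inj₁ eq | _       = zero , eq
... | inj₂ eq | i , eq′ = suc i , trans eq eq′

maximum-≡ : ∀ {n b} (f : Vector ℕ n) k → (∀ i → f i ≤ b) → f k ≡ b → maximum f ≡ b
maximum-≡ f k f≤b fk≡b =
  ≤-antisym (maximum-lub f f≤b) (subst (_≤ maximum f) fk≡b (≤-maximum f k))

sum-mono-≤ : ∀ {n} (f g : Vector ℕ n) → (∀ i → f i ≤ g i) → sum f ≤ sum g
sum-mono-≤ {zero}  f g f≤g = z≤n
sum-mono-≤ {suc n} f g f≤g =
  +-mono-≤ (f≤g zero) (sum-mono-≤ (f ∘ suc) (g ∘ suc) (f≤g ∘ suc))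

+-tight : ∀ {x y x′ y′} → x ≤ x′ → y ≤ y′ → x′ + y′ ≤ x + y → x′ ≤ x × y′ ≤ y
+-tight {x} {y} {x′} {y′} x≤x′ y≤y′ le =
  +-cancelʳ-≤ y′ x′ x (≤-trans le (+-monoʳ-≤ x y≤y′)) ,
  +-cancelˡ-≤ x′ y′ y (≤-trans le (+-monoˡ-≤ y x≤x′))

sum-tight : ∀ {n} (f g : Vector ℕ n) → (∀ i → f i ≤ g i) → sum g ≤ sum f →
            ∀ i → g i ≤ f i
sum-tight {suc n} f g f≤g le
  with +-tight (f≤g zero) (sum-mono-≤ (f ∘ suc) (g ∘ suc) (f≤g ∘ suc)) le
... | g₀≤f₀ , rest = λ where
  zero    → g₀≤f₀
  (suc i) → sum-tight (f ∘ suc) (g ∘ suc) (f≤g ∘ suc) rest i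

count-cong : ∀ {P Q : Set} (P? : Dec P) (Q? : Dec Q) → P ⇔ Q → count P? ≡ count Q?
count-cong P? Q? P⇔Q = cong (λ b → if b then 1 else 0) (does-⇔ P⇔Q P? Q?)

interval? : ∀ p q m → Dec (p ≤ m × m < q)
interval? p q m = (p ≤? m) ×-dec (m <? q)

sum-interval : ∀ n p q → ∑[ u < n ] count (interval? p q (toℕ u)) ≡ n ⊓ q ∸ p
sum-interval zero    p       q       = sym (0∸n≡0 p)
sum-interval (suc n) p       zero    = trans
  (sum-cong-≗ λ u → count-cong (interval? p 0 (toℕ {suc n} u)) (interval? 1 0 0)
    (mk⇔ (λ ()) (λ ())))
  (trans (sum-replicate-zero (suc n)) (sym (0∸n≡0 p)))
sum-interval (suc n) zero    (suc q) = cong suc (trans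
  (sum-cong-≗ {n} λ u → count-cong (interval? 0 (suc q) (suc (toℕ u))) (interval? 0 q (toℕ u))
    (mk⇔ (λ (_ , b) → z≤n , s≤s⁻¹ b) (λ (_ , b) → z≤n , s≤s b)))
  (sum-interval n 0 q))
sum-interval (suc n) (suc p) (suc q) = trans
  (sum-cong-≗ {n} λ u → count-cong (interval? (suc p) (suc q) (suc (toℕ u))) (interval? p q (toℕ u))
    (mk⇔ (λ (a , b) → s≤s⁻¹ a , s≤s⁻¹ b) (λ (a , b) → s≤s a , s≤s b)))
  (sum-interval n p q)

entryDegree : ∀ n → ℕ → Fin n → ℕ
entryDegree n a v = a ⊓ (n ∸ suc (toℕ v)) + a ⊓ toℕ v

outDegree-forwardArcs : ∀ n a v → outDegree (forwardArcs n a) v ≡ a ⊓ (n ∸ suc (toℕ v))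
outDegree-forwardArcs n a v = begin
  outDegree (forwardArcs n a) v
    ≡⟨ sum-cong-≗ {n} (λ u → count-cong ((i <? toℕ u) ×-dec (toℕ u ≤? i + a))
         (interval? (suc i) (suc (i + a)) (toℕ u)) (mk⇔ (map₂ s≤s) (map₂ s≤s⁻¹))) ⟩
  ∑[ u < n ] count (interval? (suc i) (suc (i + a)) (toℕ u))
    ≡⟨ sum-interval n (suc i) (suc (i + a)) ⟩
  n ⊓ (suc i + a) ∸ suc i
    ≡⟨ ∸-distribʳ-⊓ (suc i) n (suc i + a) ⟩
  (n ∸ suc i) ⊓ (suc i + a ∸ suc i)
    ≡⟨ cong ((n ∸ suc i) ⊓_) (m+n∸m≡n (suc i) a) ⟩
  (n ∸ suc i) ⊓ a
    ≡⟨ ⊓-comm _ a ⟩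
  a ⊓ (n ∸ suc i) ∎
  where
  open ≡-Reasoning
  i = toℕ v

∸-≤-⇔ : ∀ m a o → m ∸ a ≤ o ⇔ m ≤ o + a
∸-≤-⇔ m a o = mk⇔ (λ le → subst (m ≤_) (+-comm a o) (≤-trans (m≤n+m∸n m a) (+-monoʳ-≤ a le)))
                  (λ le → m≤n+o⇒m∸n≤o m a (subst (m ≤_) (+-comm o a) le))

m∸[m∸n]≡n⊓m : ∀ m n → m ∸ (m ∸ n) ≡ n ⊓ m
m∸[m∸n]≡n⊓m m n = trans (sym (cong (_∸ (m ∸ n)) (m⊓n+n∸m≡n n m))) (m+n∸n≡m (n ⊓ m) (m ∸ n))

inDegree-forwardArcs : ∀ n a v → inDegree (forwardArcs n a) v ≡ a ⊓ toℕ v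
inDegree-forwardArcs n a v = begin
  inDegree (forwardArcs n a) v
    ≡⟨ sum-cong-≗ {n} (λ u → count-cong ((toℕ u <? i) ×-dec (i ≤? toℕ u + a))
         (interval? (i ∸ a) i (toℕ u))
         (mk⇔ (swap ∘ map₂ (from (∸-≤-⇔ i a (toℕ u)))) (map₂ (to (∸-≤-⇔ i a (toℕ u))) ∘ swap))) ⟩
  ∑[ u < n ] count (interval? (i ∸ a) i (toℕ u))
    ≡⟨ sum-interval n (i ∸ a) i ⟩
  n ⊓ i ∸ (i ∸ a)
    ≡⟨ cong (_∸ (i ∸ a)) (m≥n⇒m⊓n≡n (<⇒≤ (toℕ<n v))) ⟩
  i ∸ (i ∸ a)
    ≡⟨ m∸[m∸n]≡n⊓m i a ⟩
  a ⊓ i ∎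
  where
  open ≡-Reasoning
  open Equivalence using (to; from)
  i = toℕ v

degree-forwardArcs : ∀ n a v → degree (forwardArcs n a) v ≡ entryDegree n a v
degree-forwardArcs n a v = cong₂ _+_ (outDegree-forwardArcs n a v) (inDegree-forwardArcs n a v)

backwardArcs-transpose : ∀ n a u v → backwardArcs n a u v ≡ forwardArcs n a v u
backwardArcs-transpose n a u v = count-cong
  ((toℕ v <? toℕ u) ×-dec (toℕ u ∸ a ≤? toℕ v))
  ((toℕ v <? toℕ u) ×-dec (toℕ u ≤? toℕ v + a))
  (mk⇔ (map₂ (to (∸-≤-⇔ _ a _))) (map₂ (from (∸-≤-⇔ _ a _))))
  where open Equivalence using (to; from)

degree-backwardArcs : ∀ n a v → degree (backwardArcs n a) v ≡ entryDegree n a v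
degree-backwardArcs n a v = begin
  outDegree (backwardArcs n a) v + inDegree (backwardArcs n a) v
    ≡⟨ cong₂ _+_ (sum-cong-≗ (backwardArcs-transpose n a v))
                 (sum-cong-≗ (λ u → backwardArcs-transpose n a u v)) ⟩
  inDegree (forwardArcs n a) v + outDegree (forwardArcs n a) v
    ≡⟨ +-comm (inDegree (forwardArcs n a) v) _ ⟩
  degree (forwardArcs n a) v
    ≡⟨ degree-forwardArcs n a v ⟩
  entryDegree n a v ∎
  where open ≡-Reasoning

degree-entryArcs : ∀ n index a v → degree (entryArcs n index a) v ≡ entryDegree n a v
degree-entryArcs n index a v with parity index
... | 1ℙ = degree-forwardArcs n a v
... | 0ℙ = degree-backwardArcs n a v

degree-∑ : ∀ {n t} (G : Fin t → MultiDigraph n) v →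
           degree (λ u w → ∑[ i < t ] G i u w) v ≡ ∑[ i < t ] degree (G i) v
degree-∑ {n} {t} G v = begin
  ∑[ u < n ] ∑[ i < t ] G i v u + ∑[ u < n ] ∑[ i < t ] G i u v
    ≡⟨ cong₂ _+_ (∑-comm (λ u i → G i v u)) (∑-comm (λ u i → G i u v)) ⟩
  ∑[ i < t ] outDegree (G i) v + ∑[ i < t ] inDegree (G i) v
    ≡⟨ ∑-distrib-+ {t} (λ i → outDegree (G i) v) (λ i → inDegree (G i) v) ⟨
  ∑[ i < t ] degree (G i) v ∎
  where open ≡-Reasoning

degree-ornated : ∀ n {l} (s : OrderedString l) v →
                 degree (ornated n s) v ≡ ∑[ j < l ] entryDegree n (s j) v
degree-ornated n s v = trans
  (degree-∑ (λ j → entryArcs n (suc (toℕ j)) (s j)) v)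
  (sum-cong-≗ λ j → degree-entryArcs n (suc (toℕ j)) (s j) v)

doubleSum : ∀ {l} → OrderedString l → ℕ
doubleSum {l} s = ∑[ j < l ] (s j + s j)

entryDegree-≤ : ∀ n a v → entryDegree n a v ≤ a + a
entryDegree-≤ n a v = +-mono-≤ (m⊓n≤m a _) (m⊓n≤m a _)

entryDegree-tight : ∀ n a v → a + a ≤ entryDegree n a v → a ≤ n ∸ suc (toℕ v) × a ≤ toℕ v
entryDegree-tight n a v le with +-tight (m⊓n≤m a _) (m⊓n≤m a _) le
... | a≤later , a≤earlier = m≤n⊓o⇒m≤o a _ a≤later , m≤n⊓o⇒m≤o a _ a≤earlier

degree-ornated-≤ : ∀ n {l} (s : OrderedString l) v → degree (ornated n s) v ≤ doubleSum s
degree-ornated-≤ n s v rewrite degree-ornated n s v =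
  sum-mono-≤ _ _ λ j → entryDegree-≤ n (s j) v

degree-ornated-tight : ∀ n {l} (s : OrderedString l) v → doubleSum s ≤ degree (ornated n s) v →
                       maximum s ≤ n ∸ suc (toℕ v) × maximum s ≤ toℕ v
degree-ornated-tight n s v le rewrite degree-ornated n s v =
  maximum-lub s (proj₁ ∘ bounds) , maximum-lub s (proj₂ ∘ bounds)
  where
  bounds = λ j → entryDegree-tight n (s j) v
    (sum-tight _ _ (λ i → entryDegree-≤ n (s i) v) le j)

degree-ornated-≡ : ∀ n {l} (s : OrderedString l) v →
                   maximum s ≤ n ∸ suc (toℕ v) → maximum s ≤ toℕ v →
                   degree (ornated n s) v ≡ doubleSum s
degree-ornated-≡ n s v later earlier = trans (degree-ornated n s v)
  (sum-cong-≗ λ j → cong₂ _+_ (m≤n⇒m⊓n≡m (≤-trans (≤-maximum s j) later))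
                              (m≤n⇒m⊓n≡m (≤-trans (≤-maximum s j) earlier)))

module _ {t} {l : Fin t → ℕ} (s : ∀ i → OrderedString (l i)) where

  K : ℕ
  K = maximum (λ i → maximum (s i))

  N : ℕ
  N = 2 * K + 1

  1+K+K≡N : suc K + K ≡ N
  1+K+K≡N = lemma K
    where
    lemma : ∀ k → suc k + k ≡ 2 * k + 1
    lemma = solve-∀

  degree-generalised : ∀ n v →
    degree (generalisedOrnated n s) v ≡ ∑[ i < t ] degree (ornated n (s i)) v
  degree-generalised n v = degree-∑ (λ i → ornated n (s i)) v

  Δ-generalised-≤ : ∀ n → Δ (generalisedOrnated n s) ≤ ∑[ i < t ] doubleSum (s i)
  Δ-generalised-≤ n = maximum-lub (degree (generalisedOrnated n s)) λ v →
    subst (_≤ ∑[ i < t ] doubleSum (s i)) (sym (degree-generalised n v))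
      (sum-mono-≤ _ _ λ i → degree-ornated-≤ n (s i) v)

  order-lower-bound : ∀ n → 1 ≤ n → ∑[ i < t ] doubleSum (s i) ≤ Δ (generalisedOrnated n s) →
                      N ≤ n
  order-lower-bound n 1≤n le
    with v , Δ≡ ← maximum-attained 1≤n (degree (generalisedOrnated n s)) = begin
    N                                  ≡⟨ 1+K+K≡N ⟨
    suc K + K                          ≡⟨ +-comm (suc K) K ⟩
    K + suc K                          ≤⟨ +-mono-≤ (maximum-lub _ (proj₁ ∘ bounds))
                                                   (s≤s (maximum-lub _ (proj₂ ∘ bounds))) ⟩
    n ∸ suc (toℕ v) + suc (toℕ v)      ≡⟨ m∸n+n≡m (toℕ<n v) ⟩
    n                                  ∎
    where
    open ≤-Reasoning
    bounds = λ i → degree-ornated-tight n (s i) v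
      (sum-tight _ _ (λ i → degree-ornated-≤ n (s i) v)
        (≤-trans le (≤-reflexive (trans Δ≡ (degree-generalised n v)))) i)

  K<N : K < N
  K<N = subst (K <_) 1+K+K≡N (m≤m+n (suc K) K)

  centre : Fin N
  centre = fromℕ< K<N

  degree-centre : ∀ i → degree (ornated N (s i)) centre ≡ doubleSum (s i)
  degree-centre i = degree-ornated-≡ N (s i) centre
    (subst (maximum (s i) ≤_) (sym later) max≤K)
    (subst (maximum (s i) ≤_) (sym (toℕ-fromℕ< K<N)) max≤K)
    where
    max≤K = ≤-maximum (λ i → maximum (s i)) i
    later : N ∸ suc (toℕ centre) ≡ K
    later = trans (cong₂ (λ n v → n ∸ suc v) (sym 1+K+K≡N) (toℕ-fromℕ< K<N)) (m+n∸m≡n (suc K) K)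

  Δ-ornated-N : ∀ i → Δ (ornated N (s i)) ≡ doubleSum (s i)
  Δ-ornated-N i = maximum-≡ _ centre (degree-ornated-≤ N (s i)) (degree-centre i)

  Δ-generalised-N : Δ (generalisedOrnated N s) ≡ ∑[ i < t ] doubleSum (s i)
  Δ-generalised-N = ≤-antisym (Δ-generalised-≤ N)
    (subst (_≤ Δ (generalisedOrnated N s))
      (trans (degree-generalised N centre) (sum-cong-≗ degree-centre))
      (≤-maximum (degree (generalisedOrnated N s)) centre))

theorem4p2 : (t : ℕ) → 1 ≤ t →
    (l : Fin t → ℕ) → (∀ i → 1 ≤ l i) →
    (s : ∀ i → OrderedString (l i)) →
    let n = 2 * maximum (λ i → maximum (s i)) + 1 in
    SmallestAttainingMaxDegree (λ n′ → generalisedOrnated n′ s) n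
    × Δ (generalisedOrnated n s) ≡ ∑[ j < t ] Δ (ornated n (s j))
theorem4p2 t _ l _ s =
  ((m≤n+m 1 (2 * K s) ,
    λ n′ _ → ≤-trans (Δ-generalised-≤ s n′) (≤-reflexive (sym (Δ-generalised-N s)))) ,
   λ m (1≤m , attains) → order-lower-bound s m 1≤m
     (≤-trans (≤-reflexive (sym (Δ-generalised-N s)))
       (attains (N s) (m≤n+m 1 (2 * K s))))) ,
  trans (Δ-generalised-N s) (sym (sum-cong-≗ (Δ-ornated-N s)))
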